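{- Let $n\ge 1$ and $s$ be integers with $2\le s\le n+1$, and let $\mathcal{F}\subseteq 2^{[n]}$ be an $s$-saturated family. Then $$|\mathcal{F}|\;\ge\;\left(1-\frac1s\right)\cdot 2^{n}+\left(\frac{2^{s-1}}{s}-1\right)\cdot 2^{g(n,s)},$$ where $$g(n,s):=\max\left\{t\in\{0,1,\dots,n\}:\ \sum_{i=0}^{t}\binom{n}{i}\le\frac{2^{n}-(2^{s-1}-s)\,2^{t}}{s}\right\}.$$
   Context: $[n]=\{1,\dots,n\}$ and $2^{[n]}$ is the set of all subsets of $[n]$. A matching of size $s$ in a family $\mathcal{F}\subseteq 2^{[n]}$ is a choice of $A_1,\dots,A_s\in\mathcal{F}$ with $A_i\cap A_j=\emptyset$ for all $i\ne j$ (the sets are not required to be distinct; thus $\emptyset$ counts as disjoint from itself, and a family containing $\emptyset$ contains a matching of size $s$). A family $\mathcal{F}\subseteq 2^{[n]}$ is $s$-saturated if it contains no matching of size $s$, and for every $A\in 2^{[n]}\setminus\mathcal{F}$ the family $\mathcal{F}\cup\{A\}$ contains a matching of size $s$. -}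

module Defs where

open import Data.Fin.Base using (Fin)
open import Data.Fin.Subset as Subset using (Subset; inside; outside; ⊥)
open import Data.Integer.Base as ℤ using (+_)
import Data.Integer.Properties as ℤ
open import Data.Integer.Tactic.RingSolver using (solve-∀)
open import Data.List.Base using (List; []; _∷_; _++_; map; filter; length; upTo)
open import Data.List.Extrema.Nat using (max; xs≤max; argmax-sel)
open import Data.List.Membership.Propositional.Properties
  using (∈-filter⁺; ∈-filter⁻; ∈-upTo⁺; ∈-upTo⁻)
import Data.List.Relation.Unary.All as All
open import Data.Nat.Base as ℕ using (ℕ; zero; suc; NonZero; _^_; _∸_; z≤n; s≤s)
open import Data.Nat.ListAction using (sum)
open import Data.Nat.Combinatorics using (_C_; nCn≡1; nCk≡nC[n∸k])
import Data.Nat.Properties as ℕ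
open import Data.Product.Base using (Σ-syntax; _×_; _,_)
open import Data.Rational.Base as ℚ using (ℚ; _/_; _≤_)
import Data.Rational.Properties as ℚ
import Data.Rational.Unnormalised.Base as ℚᵘ
import Data.Rational.Unnormalised.Properties as ℚᵘ
open import Data.Sum.Base using (inj₁; inj₂)
open import Data.Vec.Base using ([]; _∷_)
open import Function.Base using (id)
open import Level using (0ℓ)
open import Relation.Binary.PropositionalEquality
open import Relation.Nullary using (¬_; Dec)
open import Relation.Unary using (Pred; Decidable; _∈_; _∉_; _∪_; ｛_｝)

Family : ℕ → Set₁
Family n = Pred (Subset n) 0ℓ

subsets : ∀ n → List (Subset n)
subsets zero    = [] ∷ []
subsets (suc n) = map (outside ∷_) (subsets n) ++ map (inside ∷_) (subsets n)

-- `subsets n` lists every subset exactly once, so this is the cardinality of F.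
card : ∀ {n} {F : Family n} → Decidable F → ℕ
card {n} F? = length (filter F? (subsets n))

-- The sets A i need not be distinct: ⊥ may be repeated.
HasMatching : ∀ {n} → ℕ → Family n → Set
HasMatching {n} s F = Σ[ A ∈ (Fin s → Subset n) ]
  (∀ i → A i ∈ F) × (∀ i j → i ≢ j → A i Subset.∩ A j ≡ ⊥)

Saturated : ∀ {n} → ℕ → Family n → Set
Saturated s F = ¬ HasMatching s F × (∀ A → A ∉ F → HasMatching s (F ∪ ｛ A ｝))

fromℕ : ℕ → ℚ
fromℕ m = + m / 1

-- The numerator is an integer because 2 ^ n - (2 ^ (s - 1) - s) 2 ^ t may be
-- negative.
Admissible : ∀ n s .{{_ : NonZero s}} → ℕ → Set
Admissible n s t =
  fromℕ (sum (map (n C_) (upTo (suc t))))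
    ≤ (+ (2 ^ n) ℤ.- (+ (2 ^ (s ∸ 1)) ℤ.- + s) ℤ.* + (2 ^ t)) / s

admissible? : ∀ n s .{{_ : NonZero s}} t → Dec (Admissible n s t)
admissible? n s t = _ ℚ.≤? _

-- The default value 0 of `max` is itself admissible when s ≤ n + 1; see g-max.
g : ∀ n s .{{_ : NonZero s}} → ℕ
g n s = max 0 (filter (admissible? n s) (upTo (suc n)))

private
  Σ₀≡1 : ∀ n → sum (map (n C_) (upTo 1)) ≡ 1
  Σ₀≡1 n = cong (ℕ._+ 0) (trans (nCk≡nC[n∸k] {0} {n} z≤n) (nCn≡1 n))

  1≤N/s : ∀ N r → + suc r ℤ.≤ N → fromℕ 1 ≤ N / suc r
  1≤N/s N r s≤N = ℚ.toℚᵘ-cancel-≤ (ℚᵘ.≤-respʳ-≃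
    (ℚᵘ.≃-sym (ℚ.toℚᵘ-fromℚᵘ (ℚᵘ.mkℚᵘ N r)))
    (ℚᵘ.*≤* (subst₂ ℤ._≤_ (sym (ℤ.*-identityˡ (+ suc r))) (sym (ℤ.*-identityʳ N)) s≤N)))

  c≤a-[b-c] : ∀ {a b} c → b ℤ.≤ a → c ℤ.≤ a ℤ.- (b ℤ.- c) ℤ.* + 1
  c≤a-[b-c] {a} {b} c b≤a = subst₂ ℤ._≤_ (ℤ.+-identityˡ c) (sym (lemma a b c))
    (ℤ.+-monoˡ-≤ c (ℤ.i≤j⇒0≤j-i b≤a))
    where
    lemma : ∀ a b c → a ℤ.- (b ℤ.- c) ℤ.* + 1 ≡ a ℤ.- b ℤ.+ c
    lemma = solve-∀

  0-admissible : ∀ n s .{{_ : NonZero s}} → s ℕ.≤ suc n → Admissible n s 0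
  0-admissible n (suc r) (s≤s r≤n) =
    subst (λ k → fromℕ k ≤ (+ (2 ^ n) ℤ.- (+ (2 ^ r) ℤ.- + suc r) ℤ.* + 1) / suc r)
      (sym (Σ₀≡1 n))
      (1≤N/s _ r (c≤a-[b-c] (+ suc r) (ℤ.+≤+ (ℕ.^-monoʳ-≤ 2 r≤n))))

  module _ {P : ℕ → Set} (P? : Decidable P) (n : ℕ) where

    ts : List ℕ
    ts = filter P? (upTo (suc n))

    max-member : P 0 → max 0 ts ℕ.≤ n × P (max 0 ts)
    max-member p₀ with argmax-sel id 0 ts
    ... | inj₁ eq   = subst (λ t → t ℕ.≤ n × P t) (sym eq) (z≤n , p₀)
    ... | inj₂ g∈ts = let g∈ , p = ∈-filter⁻ P? {xs = upTo (suc n)} g∈ts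
                      in ℕ.≤-pred (∈-upTo⁻ g∈) , p

    max-upper : ∀ t → t ℕ.≤ n → P t → t ℕ.≤ max 0 ts
    max-upper t t≤n p = All.lookup (xs≤max 0 ts) (∈-filter⁺ P? (∈-upTo⁺ (s≤s t≤n)) p)

g-max : ∀ n s .{{_ : NonZero s}} → s ℕ.≤ suc n →
        (g n s ℕ.≤ n × Admissible n s (g n s)) ×
        (∀ t → t ℕ.≤ n → Admissible n s t → t ℕ.≤ g n s)
g-max n s s≤1+n =
  max-member (admissible? n s) n (0-admissible n s s≤1+n) , max-upper (admissible? n s) n

{-# OPTIONS --safe #-}
module Submission where

-- Let m = s − 1, let D be the complement of F and T ∈ D. By saturation every set of D is disjoint
-- from m pairwise disjoint members of F; let A₁, …, Aₘ be such members for T. A family has at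
-- least as many members as there are sets that it strongly shatters. Let R consist of the sets Z
-- that cut no Aₖ and for which { k : Aₖ ⊆ Z } is not an initial segment; |R| ≥ (2ᵐ − s) 2^|T|.
-- For 0 ≤ i ≤ m the family of all Z ∉ R containing i but not i + 1 disjoint members of F strongly
-- shatters each Y ∈ D: choose X₁, …, Xₘ ∈ F disjoint from Y and from each other, and take all Z
-- that contain X₁, …, Xᵢ and miss Xᵢ₊₁, …, Xₘ. If two Xⱼ meet a common Aₖ, order the Xⱼ so that
-- one of the two is inside Z and the other outside, and Z cuts Aₖ; otherwise the Xⱼ can be ordered
-- so that Xⱼ meets Aⱼ for all j, and only an initial segment of the Aⱼ can be inside Z. Hence
-- s |D| + (2ᵐ − s) 2^|T| ≤ 2ⁿ. This settles the theorem if some T ∈ D has size at least g(n, s);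
-- otherwise |D| is at most the number of sets of size at most g(n, s), which the definition of
-- g(n, s) bounds.

open import Defs
import Algebra.Properties.CommutativeSemigroup as CommutativeSemigroup
open import Data.Bool.Base using (true; false)
open import Data.Fin.Base as Fin using (Fin; zero; suc; punchIn; punchOut; splitAt; _↑ˡ_; _↑ʳ_)
import Data.Fin.Permutation as Perm
open Perm using (_⟨$⟩ʳ_; _∘ₚ_)
open import Data.Fin.Permutation.Components using (transpose)
open import Data.Fin.Properties as Fin using (any?; all?)
open import Data.Fin.Subset
  using (Subset; Side; inside; outside; _∈_; _∉_; _⊆_; ∣_∣; Nonempty; Empty; ⊥; _─_; ⁅_⁆; _∩_)
open import Data.Fin.Subset.Properties
  using (anySubset?; _⊆?_; _∈?_; nonempty?; drop-there; out⊆; s⊆s; ⊆-antisym; Empty-unique; ∉⊥;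
         p─q⊆p; x∈p∧x∉q⇒x∈p─q; x∈p∩q⁺; x∈p∩q⁻; x∈⁅x⁆; x∈⁅y⁆⇒x≡y)
open import Data.Integer.Base as ℤ using (+_)
import Data.Integer.Properties as ℤ
import Data.Integer.Tactic.RingSolver as ℤ-Solver
open import Data.List.Base using ([]; _∷_; _++_; map; filter; length; upTo; [_])
import Data.List.Properties as List
open import Data.Nat.Base as ℕ using (ℕ; zero; suc; NonZero; _^_; _∸_; _≤_; z≤n; s≤s; s≤s⁻¹)
open import Data.Nat.Combinatorics using (_C_; nCn≡1; nCk≡nC[n∸k]; nCk+nC[k+1]≡[n+1]C[k+1])
open import Data.Nat.ListAction using (sum)
open import Data.Nat.ListAction.Properties using (sum-++)
open import Data.Nat.Properties as ℕ
  using (_≟_; _<?_; ≤-refl; ≤-trans; ≤-reflexive; ≤-antisym; m≤n⇒m<n∨m≡n; m≤n⇒m≤n+o; m≤m+n;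
         suc-injective; +-mono-≤; +-comm; +-identityʳ; *-distribʳ-+)
import Data.Nat.Tactic.RingSolver as ℕ-Solver
open import Data.Product.Base using (∃; _×_; _,_; proj₁; proj₂)
open import Data.Rational.Base as ℚ using (1ℚ; _/_; _+_; _-_; _*_; _≥_)
import Data.Rational.Properties as ℚ
import Data.Rational.Solver as ℚ
import Data.Rational.Unnormalised.Base as ℚᵘ
import Data.Rational.Unnormalised.Properties as ℚᵘ
open import Data.Sum.Base using (_⊎_; inj₁; inj₂)
open import Data.Unit.Base using (⊤; tt)
open import Data.Vec.Base using ([]; _∷_; here; there)
import Data.Vec.Functional as Vector
import Data.Vec.Properties as Vec
open import Function.Base using (_∘_; id; case_of_)
open import Function.Bundles using (Injection)
open import Function.Definitions using (Injective)
open import Function.Properties.Inverse using (↔⇒↣)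
open import Level using (0ℓ)
open import Relation.Binary.PropositionalEquality hiding ([_])
open import Relation.Nullary
  using (¬_; yes; no; does; contradiction; ¬?; _×-dec_; _⊎-dec_; _→-dec_)
open import Relation.Nullary.Decidable using (decidable-stable; dec-true; dec-false)
open import Relation.Unary using (Pred; Decidable)

open CommutativeSemigroup ℕ.+-commutativeSemigroup using (interchange)

private
  variable
    k m n s : ℕ

-- Counting families of sets

length-filter-map : ∀ {A B : Set} {P : Pred B 0ℓ} (P? : Decidable P) (f : A → B) xs →
  length (filter P? (map f xs)) ≡ length (filter (P? ∘ f) xs)
length-filter-map P? f []       = refl
length-filter-map P? f (x ∷ xs) with does (P? (f x))
... | true  = cong suc (length-filter-map P? f xs)
... | false = length-filter-map P? f xs

card-∷ : {P : Family (suc n)} (P? : Decidable P) →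
  card P? ≡ card (P? ∘ (outside ∷_)) ℕ.+ card (P? ∘ (inside ∷_))
card-∷ {n} P? = begin
  length (filter P? (out ++ ins))                        ≡⟨ cong length (List.filter-++ P? out ins) ⟩
  length (filter P? out ++ filter P? ins)                ≡⟨ List.length-++ (filter P? out) ⟩
  length (filter P? out) ℕ.+ length (filter P? ins)
    ≡⟨ cong₂ ℕ._+_ (length-filter-map P? (outside ∷_) (subsets n))
                 (length-filter-map P? (inside ∷_) (subsets n)) ⟩
  card (P? ∘ (outside ∷_)) ℕ.+ card (P? ∘ (inside ∷_))     ∎
  where
  open ≡-Reasoning
  out = map (outside ∷_) (subsets n)
  ins = map (inside ∷_) (subsets n)

card-mono : {P Q : Family n} (P? : Decidable P) (Q? : Decidable Q) →
  (∀ Z → P Z → Q Z) → card P? ≤ card Q?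
card-mono {zero} P? Q? P⊆Q with P? [] | Q? []
... | yes _ | yes _ = ≤-refl
... | yes p | no ¬q = contradiction (P⊆Q [] p) ¬q
... | no  _ | _     = z≤n
card-mono {suc n} P? Q? P⊆Q rewrite card-∷ P? | card-∷ Q? =
  +-mono-≤ (card-mono _ _ (P⊆Q ∘ (outside ∷_))) (card-mono _ _ (P⊆Q ∘ (inside ∷_)))

card-disjoint-⊆ : {P Q R : Family n} (P? : Decidable P) (Q? : Decidable Q) (R? : Decidable R) →
  (∀ Z → P Z → ¬ Q Z) → (∀ Z → P Z → R Z) → (∀ Z → Q Z → R Z) → card P? ℕ.+ card Q? ≤ card R?
card-disjoint-⊆ {zero} P? Q? R? dis P⊆R Q⊆R with P? [] | Q? [] | R? []
... | yes p | yes q | _     = contradiction q (dis [] p)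
... | yes p | no  _ | yes _ = ≤-refl
... | yes p | no  _ | no ¬r = contradiction (P⊆R [] p) ¬r
... | no  _ | yes _ | yes _ = ≤-refl
... | no  _ | yes q | no ¬r = contradiction (Q⊆R [] q) ¬r
... | no  _ | no  _ | _     = z≤n
card-disjoint-⊆ {suc n} P? Q? R? dis P⊆R Q⊆R rewrite card-∷ P? | card-∷ Q? | card-∷ R? =
  ≤-trans (≤-reflexive (interchange (card (P? ∘ (outside ∷_))) _ _ _))
    (+-mono-≤ (half (outside ∷_)) (half (inside ∷_)))
  where
  half = λ f → card-disjoint-⊆ (P? ∘ f) (Q? ∘ f) (R? ∘ f) (dis ∘ f) (P⊆R ∘ f) (Q⊆R ∘ f)

card-∪-∩ : {P Q : Family n} (P? : Decidable P) (Q? : Decidable Q) →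
  card (λ Z → P? Z ⊎-dec Q? Z) ℕ.+ card (λ Z → P? Z ×-dec Q? Z) ≡ card P? ℕ.+ card Q?
card-∪-∩ {zero} P? Q? with P? [] | Q? []
... | yes _ | yes _ = refl
... | yes _ | no  _ = refl
... | no  _ | yes _ = refl
... | no  _ | no  _ = refl
card-∪-∩ {suc n} P? Q?
  rewrite card-∷ (λ Z → P? Z ⊎-dec Q? Z) | card-∷ (λ Z → P? Z ×-dec Q? Z) | card-∷ P? | card-∷ Q? = begin
  _ ≡⟨ interchange (card (λ Z → P? (outside ∷ Z) ⊎-dec Q? (outside ∷ Z))) _ _ _ ⟩
  _ ≡⟨ cong₂ ℕ._+_ (card-∪-∩ (P? ∘ (outside ∷_)) (Q? ∘ (outside ∷_)))
                 (card-∪-∩ (P? ∘ (inside ∷_)) (Q? ∘ (inside ∷_))) ⟩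
  _ ≡⟨ interchange (card (P? ∘ (outside ∷_))) _ _ _ ⟩
  _ ∎
  where open ≡-Reasoning

card-∅ : {P : Family n} (P? : Decidable P) → (∀ Z → ¬ P Z) → card P? ≡ 0
card-∅ {zero} P? ∅ with P? []
... | yes p = contradiction p (∅ [])
... | no  _ = refl
card-∅ {suc n} P? ∅
  rewrite card-∷ P? | card-∅ (P? ∘ (outside ∷_)) (∅ ∘ (outside ∷_)) = card-∅ _ (∅ ∘ (inside ∷_))

card-∁ : {P : Family n} (P? : Decidable P) → card P? ℕ.+ card (¬? ∘ P?) ≡ 2 ^ n
card-∁ {zero} P? with P? []
... | yes _ = refl
... | no  _ = refl
card-∁ {suc n} P? rewrite card-∷ P? | card-∷ (¬? ∘ P?) | +-identityʳ (2 ^ n) =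
  trans (interchange (card (P? ∘ (outside ∷_))) _ _ _)
    (cong₂ ℕ._+_ (card-∁ (P? ∘ (outside ∷_))) (card-∁ (P? ∘ (inside ∷_))))

2^∣T∣≤card-⊆ : ∀ (T : Subset n) → 2 ^ ∣ T ∣ ≤ card (_⊆? T)
2^∣T∣≤card-⊆ []            = ≤-refl
2^∣T∣≤card-⊆ (outside ∷ T) rewrite card-∷ (_⊆? (outside ∷ T)) =
  m≤n⇒m≤n+o _ (≤-trans (2^∣T∣≤card-⊆ T) (card-mono (_⊆? T) _ (λ _ → s⊆s)))
2^∣T∣≤card-⊆ (inside ∷ T)  rewrite card-∷ (_⊆? (inside ∷ T)) | +-identityʳ (2 ^ ∣ T ∣) =
  +-mono-≤ (≤-trans (2^∣T∣≤card-⊆ T) (card-mono (_⊆? T) _ (λ _ → out⊆)))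
           (≤-trans (2^∣T∣≤card-⊆ T) (card-mono (_⊆? T) _ (λ _ → s⊆s)))

-- Halving by the first index splits the union of the `Q J` into two parts, which are disjoint
-- because `Z` determines `J`. In the application `J` records which blocks lie inside `Z`.
card-⋃-disjoint : {W : Family m} (W? : Decidable W)
  {Q : Subset m → Family n} (Q? : ∀ J → Decidable (Q J)) {R : Family n} (R? : Decidable R) →
  ∀ c → (∀ J → W J → c ≤ card (Q? J)) →
  (∀ {J J′ Z} → W J → W J′ → Q J Z → Q J′ Z → J ≡ J′) → (∀ {J Z} → W J → Q J Z → R Z) →
  card W? ℕ.* c ≤ card R?
card-⋃-disjoint {zero} W? Q? R? c c≤ unique Q⊆R with W? []
... | yes w = ≤-trans (≤-reflexive (+-identityʳ c))
                (≤-trans (c≤ [] w) (card-mono (Q? []) R? (λ _ → Q⊆R w)))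
... | no  _ = z≤n
card-⋃-disjoint {suc m} {n} {W} W? {Q} Q? {R} R? c c≤ unique Q⊆R = begin
  card W? ℕ.* c                                                ≡⟨ cong (ℕ._* c) (card-∷ W?) ⟩
  (card (W? ∘ (outside ∷_)) ℕ.+ card (W? ∘ (inside ∷_))) ℕ.* c   ≡⟨ *-distribʳ-+ c (card (W? ∘ (outside ∷_))) _ ⟩
  card (W? ∘ (outside ∷_)) ℕ.* c ℕ.+ card (W? ∘ (inside ∷_)) ℕ.* c ≤⟨ +-mono-≤ (half outside) (half inside) ⟩
  card (⋃Q? outside) ℕ.+ card (⋃Q? inside)
    ≤⟨ card-disjoint-⊆ (⋃Q? outside) (⋃Q? inside) R? dis (⋃Q⊆R outside) (⋃Q⊆R inside) ⟩
  card R?                                                    ∎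
  where
  open ℕ.≤-Reasoning
  ⋃Q : Side → Family n
  ⋃Q b Z = ∃ λ J → W (b ∷ J) × Q (b ∷ J) Z
  ⋃Q? : ∀ b → Decidable (⋃Q b)
  ⋃Q? b Z = anySubset? (λ J → W? (b ∷ J) ×-dec Q? (b ∷ J) Z)
  ⋃Q⊆R : ∀ b Z → ⋃Q b Z → R Z
  ⋃Q⊆R b Z (J , w , q) = Q⊆R w q
  dis : ∀ Z → ⋃Q outside Z → ¬ ⋃Q inside Z
  dis Z (J , w , q) (J′ , w′ , q′) with unique w w′ q q′
  ... | ()
  half : ∀ b → card (W? ∘ (b ∷_)) ℕ.* c ≤ card (⋃Q? b)
  half b = card-⋃-disjoint (W? ∘ (b ∷_)) (Q? ∘ (b ∷_)) (⋃Q? b) c (c≤ ∘ (b ∷_))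
    (λ w w′ q q′ → Vec.∷-injectiveʳ (unique w w′ q q′)) (λ w q → _ , w , q)

card-∣∣≡k : ∀ n k → card (λ (Z : Subset n) → ∣ Z ∣ ≟ k) ≡ n C k
card-∣∣≡k zero    zero    = refl
card-∣∣≡k zero    (suc k) = refl
card-∣∣≡k (suc n) zero    = begin
  card (λ (Z : Subset (suc n)) → ∣ Z ∣ ≟ 0)              ≡⟨ card-∷ (λ (Z : Subset (suc n)) → ∣ Z ∣ ≟ 0) ⟩
  card (λ (Z : Subset n) → ∣ Z ∣ ≟ 0) ℕ.+ card (λ (Z : Subset n) → suc ∣ Z ∣ ≟ 0)
    ≡⟨ cong₂ ℕ._+_ (card-∣∣≡k n 0) (card-∅ (λ (Z : Subset n) → suc ∣ Z ∣ ≟ 0) (λ _ ())) ⟩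
  n C 0 ℕ.+ 0                                              ≡⟨ +-identityʳ _ ⟩
  n C 0                                                  ≡⟨ trans (nC0≡1 n) (sym (nC0≡1 (suc n))) ⟩
  suc n C 0                                              ∎
  where
  open ≡-Reasoning
  nC0≡1 : ∀ n → n C 0 ≡ 1
  nC0≡1 n = trans (nCk≡nC[n∸k] {0} {n} z≤n) (nCn≡1 n)
card-∣∣≡k (suc n) (suc k) = begin
  card (λ (Z : Subset (suc n)) → ∣ Z ∣ ≟ suc k)          ≡⟨ card-∷ (λ (Z : Subset (suc n)) → ∣ Z ∣ ≟ suc k) ⟩
  card (λ (Z : Subset n) → ∣ Z ∣ ≟ suc k) ℕ.+ card (λ (Z : Subset n) → suc ∣ Z ∣ ≟ suc k)
    ≡⟨ cong₂ ℕ._+_ (card-∣∣≡k n (suc k)) (≤-antisym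
         (card-mono (λ (Z : Subset n) → suc ∣ Z ∣ ≟ suc k) (λ Z → ∣ Z ∣ ≟ k) (λ _ → suc-injective))
         (card-mono (λ (Z : Subset n) → ∣ Z ∣ ≟ k) (λ Z → suc ∣ Z ∣ ≟ suc k) (λ _ → cong suc))) ⟩
  n C suc k ℕ.+ card (λ (Z : Subset n) → ∣ Z ∣ ≟ k)        ≡⟨ cong (n C suc k ℕ.+_) (card-∣∣≡k n k) ⟩
  n C suc k ℕ.+ n C k                                      ≡⟨ +-comm (n C suc k) _ ⟩
  n C k ℕ.+ n C suc k                                      ≡⟨ nCk+nC[k+1]≡[n+1]C[k+1] n k ⟩
  suc n C suc k                                          ∎
  where open ≡-Reasoning

card-∣∣<k : ∀ n k → card (λ (Z : Subset n) → ∣ Z ∣ <? k) ≤ sum (map (n C_) (upTo k))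
card-∣∣<k n zero    = ≤-reflexive (card-∅ (λ (Z : Subset n) → ∣ Z ∣ <? 0) (λ _ ()))
card-∣∣<k n (suc k) = begin
  card (λ (Z : Subset n) → ∣ Z ∣ <? suc k)
    ≤⟨ card-mono (λ (Z : Subset n) → ∣ Z ∣ <? suc k) (λ Z → ∣ Z ∣ <? k ⊎-dec ∣ Z ∣ ≟ k)
         (λ _ → m≤n⇒m<n∨m≡n ∘ s≤s⁻¹) ⟩
  card (λ (Z : Subset n) → ∣ Z ∣ <? k ⊎-dec ∣ Z ∣ ≟ k)
    ≤⟨ m≤m+n _ _ ⟩
  card (λ (Z : Subset n) → ∣ Z ∣ <? k ⊎-dec ∣ Z ∣ ≟ k) ℕ.+ card (λ (Z : Subset n) → ∣ Z ∣ <? k ×-dec ∣ Z ∣ ≟ k)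
    ≡⟨ card-∪-∩ (λ (Z : Subset n) → ∣ Z ∣ <? k) (λ Z → ∣ Z ∣ ≟ k) ⟩
  card (λ (Z : Subset n) → ∣ Z ∣ <? k) ℕ.+ card (λ (Z : Subset n) → ∣ Z ∣ ≟ k)
    ≤⟨ +-mono-≤ (card-∣∣<k n k) (≤-reflexive (trans (card-∣∣≡k n k) (sym (+-identityʳ _)))) ⟩
  sum (map (n C_) (upTo k)) ℕ.+ sum (map (n C_) [ k ])
    ≡⟨ sum-++ (map (n C_) (upTo k)) _ ⟨
  sum (map (n C_) (upTo k) ++ map (n C_) [ k ])
    ≡⟨ cong sum (List.map-++ (n C_) (upTo k) _) ⟨
  sum (map (n C_) (upTo k ++ [ k ]))
    ≡⟨ cong (sum ∘ map (n C_)) (List.upTo-∷ʳ k) ⟩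
  sum (map (n C_) (upTo (suc k))) ∎
  where open ℕ.≤-Reasoning

-- Initial segments

-- J = {0, …, i − 1} for some i ≤ m.
Initial : Family m
Initial []            = ⊤
Initial (outside ∷ J) = Empty J
Initial (inside ∷ J)  = Initial J

initial? : Decidable (Initial {m})
initial? []            = yes tt
initial? (outside ∷ J) = ¬? (nonempty? J)
initial? (inside ∷ J)  = initial? J

Empty⇒Initial : (J : Subset m) → Empty J → Initial J
Empty⇒Initial []            _ = tt
Empty⇒Initial (outside ∷ J) ∅ = λ (x , x∈J) → ∅ (suc x , there x∈J)
Empty⇒Initial (inside ∷ J)  ∅ = contradiction (zero , here) ∅

initial⁺ : ∀ i {d} (J : Subset (i ℕ.+ d)) →
  (∀ k → k Fin.↑ˡ d ∈ J) → (∀ k → i Fin.↑ʳ k ∉ J) → Initial J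
initial⁺ zero    J             ⊆J ∩J = Empty⇒Initial J (λ (x , x∈J) → ∩J x x∈J)
initial⁺ (suc i) (inside ∷ J)  ⊆J ∩J = initial⁺ i J (drop-there ∘ ⊆J ∘ suc) (λ k → ∩J k ∘ there)
initial⁺ (suc i) (outside ∷ J) ⊆J ∩J with () ← ⊆J zero

card-Empty : ∀ m → card (λ (J : Subset m) → ¬? (nonempty? J)) ≤ 1
card-Empty zero    = ≤-refl
card-Empty (suc m) = begin
  card (λ (J : Subset (suc m)) → ¬? (nonempty? J))
    ≡⟨ card-∷ (λ (J : Subset (suc m)) → ¬? (nonempty? J)) ⟩
  card (λ (J : Subset m) → ¬? (nonempty? (outside ∷ J))) ℕ.+ card (λ (J : Subset m) → ¬? (nonempty? (inside ∷ J)))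
    ≡⟨ cong (card (λ (J : Subset m) → ¬? (nonempty? (outside ∷ J))) ℕ.+_)
         (card-∅ (λ (J : Subset m) → ¬? (nonempty? (inside ∷ J))) (λ _ ∅ → ∅ (zero , here))) ⟩
  card (λ (J : Subset m) → ¬? (nonempty? (outside ∷ J))) ℕ.+ 0
    ≡⟨ +-identityʳ _ ⟩
  card (λ (J : Subset m) → ¬? (nonempty? (outside ∷ J)))
    ≤⟨ card-mono (λ (J : Subset m) → ¬? (nonempty? (outside ∷ J))) (λ J → ¬? (nonempty? J))
         (λ _ ∅ (x , x∈J) → ∅ (suc x , there x∈J)) ⟩
  card (λ (J : Subset m) → ¬? (nonempty? J))
    ≤⟨ card-Empty m ⟩
  1 ∎
  where open ℕ.≤-Reasoning

-- An index outside `J` forces all later ones outside, so there is one initial `J` for each length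
-- 0, ..., m. At least 2^m - (m + 1) = 2^(s - 1) - s sets are therefore non-initial.
card-Initial : ∀ m → card (initial? {m}) ≤ suc m
card-Initial zero    = ≤-refl
card-Initial (suc m) rewrite card-∷ (initial? {suc m}) = +-mono-≤ (card-Empty m) (card-Initial m)

-- Shattering

-- Implied by strong shattering, where the sides chosen for the coordinates outside Y may not
-- depend on the earlier coordinates; unlike it, satisfied by exactly as many Y as E has members.
Shattered : Family n → Family n
Shattered E []            = E []
Shattered E (outside ∷ Y) = Shattered (E ∘ (outside ∷_)) Y ⊎ Shattered (E ∘ (inside ∷_)) Y
Shattered E (inside ∷ Y)  = Shattered (E ∘ (outside ∷_)) Y × Shattered (E ∘ (inside ∷_)) Y

shattered? : {E : Family n} → Decidable E → Decidable (Shattered E)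
shattered? E? []            = E? []
shattered? E? (outside ∷ Y) =
  shattered? (E? ∘ (outside ∷_)) Y ⊎-dec shattered? (E? ∘ (inside ∷_)) Y
shattered? E? (inside ∷ Y)  =
  shattered? (E? ∘ (outside ∷_)) Y ×-dec shattered? (E? ∘ (inside ∷_)) Y

-- The sets `Y` without the first element are counted by a union and those with it by an
-- intersection; by `card-∪-∩` the two counts add up to the sizes of the two sections of `E`.
card-Shattered : {E : Family n} (E? : Decidable E) → card (shattered? E?) ≡ card E?
card-Shattered {zero}  E? with E? []
... | yes _ = refl
... | no  _ = refl
card-Shattered {suc n} E? = begin
  card (shattered? E?)               ≡⟨ card-∷ (shattered? E?) ⟩
  card (λ Y → S₀? Y ⊎-dec S₁? Y) ℕ.+ card (λ Y → S₀? Y ×-dec S₁? Y)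
                                     ≡⟨ card-∪-∩ S₀? S₁? ⟩
  card S₀? ℕ.+ card S₁?
    ≡⟨ cong₂ ℕ._+_ (card-Shattered (E? ∘ (outside ∷_))) (card-Shattered (E? ∘ (inside ∷_))) ⟩
  card (E? ∘ (outside ∷_)) ℕ.+ card (E? ∘ (inside ∷_)) ≡⟨ card-∷ E? ⟨
  card E?                            ∎
  where
  open ≡-Reasoning
  S₀? = shattered? (E? ∘ (outside ∷_))
  S₁? = shattered? (E? ∘ (inside ∷_))

-- The hypothesis is strong shattering: `P` fixes the side of each coordinate outside `Y`, and the
-- coordinates in `Y` are free. So `P?` selects the disjunct at a coordinate outside `Y`, and both
-- conjuncts hold at a coordinate in `Y`.
cube⊆⇒Shattered : {P : Pred (Fin n) 0ℓ} (P? : Decidable P) {E : Family n} (Y : Subset n) →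
  (∀ Z → (∀ {x} → x ∉ Y → P x → x ∈ Z) → (∀ {x} → x ∉ Y → ¬ P x → x ∉ Z) → E Z) →
  Shattered E Y
cube⊆⇒Shattered P? [] cube = cube [] (λ {}) (λ {})
cube⊆⇒Shattered {P = P} P? (outside ∷ Y) cube with P? zero
... | yes p = inj₂ (cube⊆⇒Shattered (P? ∘ suc) Y λ Z h h′ → cube (inside ∷ Z)
        (λ { {zero} _ _ → here ; {suc x} x∉Y px → there (h (x∉Y ∘ there) px) })
        (λ { {zero} _ ¬p → contradiction p ¬p ; {suc x} x∉Y ¬px → h′ (x∉Y ∘ there) ¬px ∘ drop-there }))
... | no ¬p = inj₁ (cube⊆⇒Shattered (P? ∘ suc) Y λ Z h h′ → cube (outside ∷ Z)
        (λ { {zero} _ p → contradiction p ¬p ; {suc x} x∉Y px → there (h (x∉Y ∘ there) px) })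
        (λ { {zero} _ _ () ; {suc x} x∉Y ¬px → h′ (x∉Y ∘ there) ¬px ∘ drop-there }))
cube⊆⇒Shattered {P = P} P? {E} (inside ∷ Y) cube = half outside , half inside
  where
  half : ∀ b → Shattered (E ∘ (b ∷_)) Y
  half b = cube⊆⇒Shattered (P? ∘ suc) Y λ Z h h′ → cube (b ∷ Z)
    (λ { {zero} 0∉ _ → contradiction here 0∉ ; {suc x} x∉Y px → there (h (x∉Y ∘ there) px) })
    (λ { {zero} 0∉ _ → contradiction here 0∉ ; {suc x} x∉Y ¬px → h′ (x∉Y ∘ there) ¬px ∘ drop-there })

-- Combined with `cube⊆⇒Shattered`, this is the lower half of the sandwich theorem. It compares
-- sizes without an injection from `D` to `E`.
card-≤-Shattered : {D E : Family n} (D? : Decidable D) (E? : Decidable E) →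
  (∀ Y → D Y → Shattered E Y) → card D? ≤ card E?
card-≤-Shattered D? E? D⊆ =
  ≤-trans (card-mono D? (shattered? E?) D⊆) (≤-reflexive (card-Shattered E?))

-- Packings

inject-join : ∀ i {d} (x : Fin (i ℕ.+ d)) → (∃ λ k → k ↑ˡ d ≡ x) ⊎ (∃ λ k → i ↑ʳ k ≡ x)
inject-join i x with splitAt i x in eq
... | inj₁ k = inj₁ (k , Fin.splitAt⁻¹-↑ˡ eq)
... | inj₂ k = inj₂ (k , Fin.splitAt⁻¹-↑ʳ eq)

↑ˡ≢↑ʳ : ∀ {i d} (k : Fin i) (l : Fin d) → k ↑ˡ d ≢ i ↑ʳ l
↑ˡ≢↑ʳ {i} {d} k l eq
  with () ← trans (sym (Fin.splitAt-↑ˡ i k d)) (trans (cong (splitAt i) eq) (Fin.splitAt-↑ʳ i d l))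

injective⇒surjective : {f : Fin m → Fin m} → Injective _≡_ _≡_ f → ∀ y → ∃ λ x → f x ≡ y
injective⇒surjective {suc m} {f} inj y with any? (λ x → f x Fin.≟ y)
... | yes hit = hit
... | no miss = contradiction
  (Fin.injective⇒≤ {f = λ x → punchOut {i = y} {j = f x} (λ y≡ → miss (x , sym y≡))}
    (λ eq → inj (Fin.punchOut-injective {i = y} _ _ eq)))
  ℕ.1+n≰n

transpose-fst : ∀ (i j : Fin n) → transpose i j i ≡ j
transpose-fst i j rewrite dec-true (i Fin.≟ i) refl = refl

transpose-other : ∀ {i j k : Fin n} → k ≢ i → k ≢ j → transpose i j k ≡ k
transpose-other {i = i} {j} {k} k≢i k≢j
  rewrite dec-false (k Fin.≟ i) k≢i | dec-false (k Fin.≟ j) k≢j = refl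

-- Two transpositions suffice: the first takes `p` to `j` and `q` to some `r` other than `j`; the
-- second swaps `r` with `j′` and fixes `j`.
injection-through : ∀ {p q j j′ : Fin m} → p ≢ q → j ≢ j′ →
  ∃ λ (π : Fin m → Fin m) → Injective _≡_ _≡_ π × π p ≡ j × π q ≡ j′
injection-through {m} {p} {q} {j} {j′} p≢q j≢j′ =
  (π ⟨$⟩ʳ_) , injective ,
  trans (cong (transpose r j′) (transpose-fst p j)) (transpose-other j≢r j≢j′) ,
  transpose-fst r j′
  where
  r = transpose p j q
  π = Perm.transpose p j ∘ₚ Perm.transpose r j′
  injective : Injective _≡_ _≡_ (π ⟨$⟩ʳ_)
  injective = Injection.injective (↔⇒↣ π)
  j≢r : j ≢ r
  j≢r j≡r = p≢q (Injection.injective (↔⇒↣ (Perm.transpose p j)) (trans (transpose-fst p j) j≡r))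

x∈p─q⇒x∉q : ∀ (p q : Subset n) {x} → x ∈ p ─ q → x ∉ q
x∈p─q⇒x∉q (_ ∷ p) (outside ∷ q) {zero}  _          ()
x∈p─q⇒x∉q (_ ∷ p) (inside ∷ q)  {zero}  ()
x∈p─q⇒x∉q (_ ∷ p) (_ ∷ q)       {suc x} (there x∈) (there x∈q) = x∈p─q⇒x∉q p q x∈ x∈q

module _ (F : Family n) where

  -- Disjointness is stated pointwise: a point determines the index of its set. An empty set may be
  -- repeated, as in `HasMatching`.
  IsPacking : (Fin k → Subset n) → Set
  IsPacking B = (∀ i → F (B i)) × (∀ {i j x} → x ∈ B i → x ∈ B j → i ≡ j)

  NoPacking : ℕ → Set
  NoPacking k = ∀ (B : Fin k → Subset n) → ¬ IsPacking B

  reindex : {B : Fin m → Subset n} {π : Fin k → Fin m} →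
    Injective _≡_ _≡_ π → IsPacking B → IsPacking (B ∘ π)
  reindex inj (B∈F , dis) = B∈F ∘ _ , λ x∈ x∈′ → inj (dis x∈ x∈′)

  PackedOutside : ℕ → Family n
  PackedOutside k Y = ∃ λ (X : Fin k → Subset n) → IsPacking X × (∀ j {x} → x ∈ X j → x ∉ Y)

  -- For `k` = s - 1 this is what saturation contributes to the counting, besides `NoPacking s`.
  Complemented : ℕ → Set
  Complemented k = ∀ Y → ¬ F Y → PackedOutside k Y

  -- Z contains k pairwise disjoint members of F.
  Packs : ℕ → Family n
  Packs zero    Z = ⊤
  Packs (suc k) Z = ∃ λ A → F A × A ⊆ Z × Packs k (Z ─ A)

  Packs-pred : ∀ k {Z} → Packs (suc k) Z → Packs k Z
  Packs-pred zero    _                        = tt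
  Packs-pred (suc k) (A , A∈F , A⊆Z , packs) = A , A∈F , A⊆Z , Packs-pred k packs

  packing⇒packs : ∀ {B : Fin k → Subset n} {Z} → IsPacking B → (∀ i → B i ⊆ Z) → Packs k Z
  packing⇒packs {zero}  _           _   = tt
  packing⇒packs {suc k} {B} {Z} B-packing@(B∈F , dis) B⊆Z =
    B zero , B∈F zero , B⊆Z zero ,
    packing⇒packs (reindex Fin.suc-injective B-packing) λ i {x} x∈ →
      x∈p∧x∉q⇒x∈p─q (B⊆Z (suc i) x∈) λ x∈B₀ → case dis x∈ x∈B₀ of λ ()

  packs⇒packing : ∀ k {Z} → Packs k Z → ∃ λ (B : Fin k → Subset n) → IsPacking B × (∀ i → B i ⊆ Z)
  packs⇒packing zero    _ = (λ ()) , ((λ ()) , λ {}) , λ ()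
  packs⇒packing (suc k) {Z} (A , A∈F , A⊆Z , packs)
    with B , (B∈F , dis) , B⊆ ← packs⇒packing k packs =
    A Vector.∷ B , (∈F , disjoint) , ⊆Z
    where
    ∈F : ∀ i → F ((A Vector.∷ B) i)
    ∈F zero    = A∈F
    ∈F (suc i) = B∈F i
    ⊆Z : ∀ i → (A Vector.∷ B) i ⊆ Z
    ⊆Z zero    = A⊆Z
    ⊆Z (suc i) = p─q⊆p Z A ∘ B⊆ i
    disjoint : ∀ {i j x} → x ∈ (A Vector.∷ B) i → x ∈ (A Vector.∷ B) j → i ≡ j
    disjoint {zero}  {zero}  _   _   = refl
    disjoint {zero}  {suc j} x∈A x∈B = contradiction x∈A (x∈p─q⇒x∉q Z A (B⊆ j x∈B))
    disjoint {suc i} {zero}  x∈B x∈A = contradiction x∈A (x∈p─q⇒x∉q Z A (B⊆ i x∈B))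
    disjoint {suc i} {suc j} x∈  x∈′ = cong suc (dis x∈ x∈′)

  packing-++ : ∀ {i d} {B : Fin i → Subset n} {C : Fin d → Subset n} →
    IsPacking B → IsPacking C → (∀ {k l x} → x ∈ B k → x ∉ C l) → IsPacking (B Vector.++ C)
  packing-++ {i} {d} {B} {C} (B∈F , B-dis) (C∈F , C-dis) B∩C = ∈F , disjoint
    where
    ∈F : ∀ p → F ((B Vector.++ C) p)
    ∈F p with splitAt i p
    ... | inj₁ k = B∈F k
    ... | inj₂ l = C∈F l
    disjoint : ∀ {p q x} → x ∈ (B Vector.++ C) p → x ∈ (B Vector.++ C) q → p ≡ q
    disjoint {p} {q} x∈ x∈′ with splitAt i p in eqp | splitAt i q in eqq
    ... | inj₁ k | inj₂ l = contradiction x∈′ (B∩C x∈)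
    ... | inj₂ l | inj₁ k = contradiction x∈ (B∩C x∈′)
    ... | inj₁ k | inj₁ l rewrite B-dis x∈ x∈′ =
      trans (sym (Fin.splitAt⁻¹-↑ˡ eqp)) (Fin.splitAt⁻¹-↑ˡ eqq)
    ... | inj₂ k | inj₂ l rewrite C-dis x∈ x∈′ =
      trans (sym (Fin.splitAt⁻¹-↑ʳ eqp)) (Fin.splitAt⁻¹-↑ʳ eqq)

  -- Otherwise `C`, as a packing of size 1, could be put in front of `X` to give m + 1 disjoint
  -- members.
  meets : NoPacking (suc m) → {X : Fin m → Subset n} → IsPacking X → ∀ {C} → F C →
    ∃ λ j → ∃ λ x → x ∈ C × x ∈ X j
  meets noPacking {X} X-packing {C} C∈F
    with any? (λ j → any? (λ x → x ∈? C ×-dec x ∈? X j))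
  ... | yes meet = meet
  ... | no ¬meet = contradiction
    (packing-++ {B = λ (_ : Fin 1) → C} ((λ _ → C∈F) , λ { {zero} {zero} _ _ → refl }) X-packing
      (λ x∈C x∈X → ¬meet (_ , _ , x∈C , x∈X)))
    (noPacking _)

  -- Z cuts none of the blocks A k, and J is the set of blocks inside Z.
  BlockUnion : (Fin m → Subset n) → Subset m → Family n
  BlockUnion A J Z = ∀ x k → x ∈ A k → (x ∈ Z → k ∈ J) × (k ∈ J → x ∈ Z)

  blockUnion? : ∀ (A : Fin m → Subset n) J → Decidable (BlockUnion A J)
  blockUnion? A J Z = all? λ x → all? λ k →
    x ∈? A k →-dec ((x ∈? Z →-dec k ∈? J) ×-dec (k ∈? J →-dec x ∈? Z))

  -- This is the family R of the overview. The witness `J` is determined by `Z` once the blocks are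
  -- nonempty.
  Removed : (Fin m → Subset n) → Family n
  Removed A Z = ∃ λ J → ¬ Initial J × BlockUnion A J Z

  removed? : (A : Fin m → Subset n) → Decidable (Removed A)
  removed? A Z = anySubset? λ J → ¬? (initial? J) ×-dec blockUnion? A J Z

  -- Reordering a packing to avoid the removed sets

  NoRemovedBetween : ∀ i d → (A X : Fin (i ℕ.+ d) → Subset n) → Set
  NoRemovedBetween i d A X = ∀ Z → (∀ k → X (k ↑ˡ d) ⊆ Z) →
    (∀ k {x} → x ∈ X (i ↑ʳ k) → x ∉ Z) → ¬ Removed A Z

  -- Two sets of `X` that meet the same block are placed on opposite sides, so that `Z` cuts this
  -- block. If `i` or `d` is 0 there is only one side; but every block meets some `X j`, so `J` is
  -- empty or full and hence initial.
  rearrange-split : ∀ i d → NoPacking (suc (i ℕ.+ d)) →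
    {A X : Fin (i ℕ.+ d) → Subset n} → IsPacking A → IsPacking X →
    ∀ {j j′ k x x′} → j ≢ j′ → x ∈ X j → x ∈ A k → x′ ∈ X j′ → x′ ∈ A k →
    ∃ λ (π : Fin (i ℕ.+ d) → Fin (i ℕ.+ d)) → Injective _≡_ _≡_ π × NoRemovedBetween i d A (X ∘ π)
  rearrange-split zero d noPacking {A} {X} (A∈F , _) X-packing _ _ _ _ _ = id , id , clear
    where
    clear : NoRemovedBetween zero d A X
    clear Z _ X∩Z (J , ¬init , union) = ¬init (Empty⇒Initial J λ (k , k∈J) →
      let j , x , x∈A , x∈X = meets noPacking X-packing (A∈F k)
      in X∩Z j x∈X (proj₂ (union x k x∈A) k∈J))
  rearrange-split (suc i) zero noPacking {A} {X} (A∈F , _) X-packing _ _ _ _ _ = id , id , clear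
    where
    clear : NoRemovedBetween (suc i) zero A X
    clear Z X⊆Z _ (J , ¬init , union) = ¬init (initial⁺ (suc i) J (λ k → all∈ (k ↑ˡ zero)) λ ())
      where
      all∈ : ∀ k → k ∈ J
      all∈ k with meets noPacking X-packing (A∈F k)
      ... | j , x , x∈A , x∈X with inject-join (suc i) j
      ...   | inj₁ (l , refl) = proj₁ (union x k x∈A) (X⊆Z l x∈X)
  rearrange-split (suc i) (suc d) _ {A} {X} _ _ {j} {j′} {k} {x} {x′} j≢j′ x∈X x∈A x′∈X x′∈A
    -- Position `zero` is among the sets inside `Z`, and `suc i ↑ʳ zero` is the first position among
    -- those outside.
    with π , inj , π0≡j , πi≡j′ ← injection-through
           {p = zero {i ℕ.+ suc d}} {q = suc i ↑ʳ zero} {j} {j′} (λ ()) j≢j′ = π , inj , clear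
    where
    clear : NoRemovedBetween (suc i) (suc d) A (X ∘ π)
    clear Z X⊆Z X∩Z (J , _ , union) = X∩Z zero (subst (λ l → x′ ∈ X l) (sym πi≡j′) x′∈X)
      (proj₂ (union x′ k x′∈A) (proj₁ (union x k x∈A)
        (X⊆Z zero (subst (λ l → x ∈ X l) (sym π0≡j) x∈X))))

  -- Each `X j` is assigned a block that it meets. If two share a block, `rearrange-split` applies;
  -- otherwise the assignment is injective, hence a bijection, and its inverse `π` makes `X (π k)`
  -- meet `A k`.
  rearrange : ∀ i d → NoPacking (suc (i ℕ.+ d)) →
    {A X : Fin (i ℕ.+ d) → Subset n} → IsPacking A → IsPacking X →
    ∃ λ (π : Fin (i ℕ.+ d) → Fin (i ℕ.+ d)) → Injective _≡_ _≡_ π × NoRemovedBetween i d A (X ∘ π)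
  rearrange i d noPacking {A} {X} A-packing X-packing
    with met ← (λ j → meets noPacking A-packing (proj₁ X-packing j))
    with any? (λ j → any? (λ j′ → ¬? (j Fin.≟ j′) ×-dec proj₁ (met j) Fin.≟ proj₁ (met j′)))
  ... | yes (j , j′ , j≢j′ , eq) =
    let k , x , x∈X , x∈A = met j ; k′ , x′ , x′∈X , x′∈A = met j′
    in rearrange-split i d noPacking A-packing X-packing j≢j′ x∈X x∈A x′∈X
         (subst (λ l → x′ ∈ A l) (sym eq) x′∈A)
  ... | no ¬split = π , π-injective , clear
    where
    block-injective : Injective _≡_ _≡_ (proj₁ ∘ met)
    block-injective {j} {j′} eq = decidable-stable (j Fin.≟ j′) λ j≢j′ → ¬split (j , j′ , j≢j′ , eq)
    π : Fin (i ℕ.+ d) → Fin (i ℕ.+ d)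
    π k = proj₁ (injective⇒surjective block-injective k)
    block-π : ∀ k → proj₁ (met (π k)) ≡ k
    block-π k = proj₂ (injective⇒surjective block-injective k)
    π-injective : Injective _≡_ _≡_ π
    π-injective {k} {l} eq = trans (sym (block-π k)) (trans (cong (proj₁ ∘ met) eq) (block-π l))
    common : ∀ k → ∃ λ x → x ∈ X (π k) × x ∈ A k
    common k = let _ , x , x∈X , x∈A = met (π k) in x , x∈X , subst (λ l → x ∈ A l) (block-π k) x∈A
    clear : NoRemovedBetween i d A (X ∘ π)
    -- A common point of `X (π k)` and `A k` decides whether `k` is in `J`: yes for the first `i`
    -- indices, no for the last `d`.
    clear Z X⊆Z X∩Z (J , ¬init , union) = ¬init (initial⁺ i J
      (λ k → let x , x∈X , x∈A = common (k ↑ˡ d) in proj₁ (union x _ x∈A) (X⊆Z k x∈X))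
      (λ k k∈J → let x , x∈X , x∈A = common (i ↑ʳ k) in X∩Z k x∈X (proj₂ (union x _ x∈A) k∈J)))

  -- Levels, and the bound on the number of nonmembers

  Level : (Fin m → Subset n) → ℕ → Family n
  Level A i Z = Packs i Z × ¬ Removed A Z

  -- The cube over `Y` puts the sets of `lower` inside `Z` and all other points outside `Y` outside
  -- `Z`; the choice of `π` keeps it clear of `Removed A`.
  shatters : ∀ i d → NoPacking (suc (i ℕ.+ d)) →
    {A X : Fin (i ℕ.+ d) → Subset n} → IsPacking A → IsPacking X → ∀ {Y} → (∀ j {x} → x ∈ X j → x ∉ Y) →
    Shattered (λ Z → Level A i Z × ¬ Packs (suc i) Z) Y
  shatters i d noPacking {A} {X} A-packing X-packing {Y} X∩Y
    with π , π-inj , clear ← rearrange i d noPacking A-packing X-packing =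
    cube⊆⇒Shattered (λ x → any? λ k → x ∈? lower k) Y member
    where
    lower = λ k → X (π (k ↑ˡ d))
    upper = λ k → X (π (i ↑ʳ k))
    lower-packing : IsPacking lower
    lower-packing = reindex (Fin.↑ˡ-injective d _ _ ∘ π-inj) X-packing
    upper-packing : IsPacking upper
    upper-packing = reindex (Fin.↑ʳ-injective i _ _ ∘ π-inj) X-packing
    member : ∀ Z → (∀ {x} → x ∉ Y → (∃ λ k → x ∈ lower k) → x ∈ Z) →
      (∀ {x} → x ∉ Y → ¬ (∃ λ k → x ∈ lower k) → x ∉ Z) → Level A i Z × ¬ Packs (suc i) Z
    member Z ⊆Z ∩Z =
      (packing⇒packs lower-packing lower⊆Z , clear Z lower⊆Z upper∩Z) , λ packs →
        let B , B-packing , B⊆Z = packs⇒packing (suc i) packs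
        -- The i + 1 disjoint members inside `Z` and the `d` sets of `upper`, which miss `Z`, would
        -- form a packing of size m + 1.
        in noPacking _ (packing-++ B-packing upper-packing
             λ {k} {l} x∈B x∈upper → upper∩Z l x∈upper (B⊆Z k x∈B))
      where
      lower⊆Z : ∀ k → lower k ⊆ Z
      lower⊆Z k x∈ = ⊆Z (X∩Y _ x∈) (k , x∈)
      upper∩Z : ∀ k {x} → x ∈ upper k → x ∉ Z
      upper∩Z l x∈ = ∩Z (X∩Y _ x∈) λ (k , x∈′) → ↑ˡ≢↑ʳ k l (π-inj (proj₂ X-packing x∈′ x∈))

  module _ (F? : Decidable F) where

    -- `Packs` takes away one member at a time, so a search through subsets suffices and none
    -- through functions on `Fin k` arises.
    packs? : ∀ k → Decidable (Packs k)
    packs? zero    Z = yes tt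
    packs? (suc k) Z = anySubset? λ A → F? A ×-dec A ⊆? Z ×-dec packs? k (Z ─ A)

    level? : (A : Fin m → Subset n) → ∀ i → Decidable (Level A i)
    level? A i Z = packs? i Z ×-dec ¬? (removed? A Z)

    -- Level `i` contains level `suc i` and, disjoint from it, the sets `Z` with exactly `i` in
    -- place of at least `i`; by `shatters` the latter are at least as many as the nonmembers of
    -- `F`.
    card-Level-step : ∀ {i d} → i ℕ.+ d ≡ m → NoPacking (suc m) → Complemented m →
      {A : Fin m → Subset n} → IsPacking A →
      card (¬? ∘ F?) ℕ.+ card (level? A (suc i)) ≤ card (level? A i)
    card-Level-step {i = i} {d} refl noPacking complemented {A} A-packing = begin
      card (¬? ∘ F?) ℕ.+ card (level? A (suc i))
        ≤⟨ ℕ.+-monoˡ-≤ _ (card-≤-Shattered (¬? ∘ F?) exact? λ Y Y∉F →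
             let X , X-packing , X∩Y = complemented Y Y∉F
             in shatters i d noPacking A-packing X-packing X∩Y) ⟩
      card exact? ℕ.+ card (level? A (suc i))
        ≤⟨ card-disjoint-⊆ exact? (level? A (suc i)) (level? A i)
             (λ { Z (_ , ¬packs) (packs , _) → ¬packs packs }) (λ _ → proj₁)
             (λ { Z (packs , ¬removed) → Packs-pred i packs , ¬removed }) ⟩
      card (level? A i) ∎
      where
      open ℕ.≤-Reasoning
      exact? : Decidable (λ Z → Level A i Z × ¬ Packs (suc i) Z)
      exact? Z = level? A i Z ×-dec ¬? (packs? (suc i) Z)

    -- This telescopes `card-Level-step` over the levels 0, ..., k - 1; `k` = m + 1 takes in all s
    -- of them.
    card-Level : NoPacking (suc m) → Complemented m → {A : Fin m → Subset n} → IsPacking A →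
      ∀ k → k ≤ suc m → k ℕ.* card (¬? ∘ F?) ℕ.+ card (level? A k) ≤ card (level? A 0)
    card-Level _ _ _ zero _ = ℕ.≤-refl
    card-Level noPacking complemented {A} A-packing (suc k) (s≤s k≤m) = begin
      (M ℕ.+ k ℕ.* M) ℕ.+ card (level? A (suc k)) ≡⟨ cong (ℕ._+ card (level? A (suc k))) (ℕ.+-comm M _) ⟩
      (k ℕ.* M ℕ.+ M) ℕ.+ card (level? A (suc k)) ≡⟨ ℕ.+-assoc (k ℕ.* M) M _ ⟩
      k ℕ.* M ℕ.+ (M ℕ.+ card (level? A (suc k)))
        ≤⟨ ℕ.+-monoʳ-≤ (k ℕ.* M) (card-Level-step (ℕ.m+[n∸m]≡n k≤m) noPacking complemented A-packing) ⟩
      k ℕ.* M ℕ.+ card (level? A k) ≤⟨ card-Level noPacking complemented A-packing k (ℕ.m≤n⇒m≤1+n k≤m) ⟩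
      card (level? A 0) ∎
      where
      open ℕ.≤-Reasoning
      M = card (¬? ∘ F?)

  -- The blocks miss `T`, so fixing those in `J` inside and every other point outside `T` outside
  -- leaves `T` free. Thus each of the 2^|T| subsets of `T` is shattered.
  2^∣T∣≤card-BlockUnion : {A : Fin m → Subset n} → IsPacking A → ∀ {T} → (∀ k {x} → x ∈ A k → x ∉ T) →
    ∀ J → 2 ^ ∣ T ∣ ≤ card (blockUnion? A J)
  2^∣T∣≤card-BlockUnion {A = A} (_ , dis) {T} A∩T J =
    ≤-trans (2^∣T∣≤card-⊆ T) (card-≤-Shattered (_⊆? T) (blockUnion? A J) λ Y Y⊆T →
      cube⊆⇒Shattered (λ x → any? λ k → k ∈? J ×-dec x ∈? A k) Y λ Z ⊆Z ∩Z x k x∈A →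
        let x∉Y = A∩T k x∈A ∘ Y⊆T in
        (λ x∈Z → decidable-stable (k ∈? J) λ k∉J →
          ∩Z x∉Y (λ (l , l∈J , x∈Al) → k∉J (subst (_∈ J) (dis x∈Al x∈A) l∈J)) x∈Z) ,
        λ k∈J → ⊆Z x∉Y (k , k∈J , x∈A))

  -- An empty member repeated m + 1 times would be a packing.
  packing⇒nonempty : NoPacking (suc m) → ∀ {B} → F B → Nonempty B
  packing⇒nonempty {m} noPacking {B} B∈F = decidable-stable (nonempty? B) λ B-empty →
    noPacking (λ _ → B) ((λ _ → B∈F) , λ x∈B → contradiction (_ , x∈B) B-empty)

  -- Block unions for different `J` are disjoint families: a point of the nonempty block `A k` shows
  -- whether `k` is in `J`.
  card-Removed : NoPacking (suc m) → {A : Fin m → Subset n} → IsPacking A →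
    ∀ {T} → (∀ k {x} → x ∈ A k → x ∉ T) →
    card (¬? ∘ initial? {m}) ℕ.* 2 ^ ∣ T ∣ ≤ card (removed? A)
  card-Removed {m} noPacking {A} A-packing {T} A∩T =
    card-⋃-disjoint (¬? ∘ initial?) (blockUnion? A) (removed? A) (2 ^ ∣ T ∣)
      (λ J _ → 2^∣T∣≤card-BlockUnion A-packing A∩T J)
      (λ _ _ union union′ → ⊆-antisym (sub union union′) (sub union′ union))
      (λ ¬init union → _ , ¬init , union)
    where
    sub : ∀ {J J′ Z} → BlockUnion A J Z → BlockUnion A J′ Z → J ⊆ J′
    sub union union′ {k} k∈J =
      let x , x∈A = packing⇒nonempty noPacking (proj₁ A-packing k)
      in proj₁ (union′ x k x∈A) (proj₂ (union x k x∈A) k∈J)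

  card-∁-bound : (F? : Decidable F) → NoPacking (suc m) → Complemented m → ∀ {T} → ¬ F T →
    suc m ℕ.* card (¬? ∘ F?) ℕ.+ card (¬? ∘ initial? {m}) ℕ.* 2 ^ ∣ T ∣ ≤ 2 ^ n
  card-∁-bound {m} F? noPacking complemented {T} T∉F
    with A , A-packing , A∩T ← complemented T T∉F = begin
    suc m ℕ.* M ℕ.+ card (¬? ∘ initial? {m}) ℕ.* 2 ^ ∣ T ∣
      -- `card-Level` leaves the size of level m + 1 as a further summand, dropped here.
      ≤⟨ +-mono-≤ (≤-trans (ℕ.m≤m+n _ _) (card-Level F? noPacking complemented A-packing (suc m) ℕ.≤-refl))
           (card-Removed noPacking A-packing A∩T) ⟩
    card (level? F? A 0) ℕ.+ card (removed? A)
      ≤⟨ ℕ.+-monoˡ-≤ _ (card-mono (level? F? A 0) (¬? ∘ removed? A) (λ _ → proj₂)) ⟩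
    card (¬? ∘ removed? A) ℕ.+ card (removed? A)
      ≡⟨ ℕ.+-comm (card (¬? ∘ removed? A)) _ ⟩
    card (removed? A) ℕ.+ card (¬? ∘ removed? A)
      ≡⟨ card-∁ (removed? A) ⟩
    2 ^ n ∎
    where
    open ℕ.≤-Reasoning
    M = card (¬? ∘ F?)

-- Saturated families

module _ {F : Family n} where

  packing⇒matching : {B : Fin s → Subset n} → IsPacking F B → HasMatching s F
  packing⇒matching {B = B} (B∈F , dis) = B , B∈F , λ i j i≢j →
    Empty-unique λ (x , x∈) →
      let x∈Bi , x∈Bj = x∈p∩q⁻ (B i) (B j) x∈ in i≢j (dis x∈Bi x∈Bj)

  module _ (F? : Decidable F) (sat : Saturated (suc m) F) where

    -- A matching in `F` with `Y` adjoined must use a set outside `F`, which is `Y`. The other m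
    -- sets miss `Y`, so none of them is the nonempty `Y` again, and all lie in `F`.
    complemented-nonempty : ∀ {Y} → Nonempty Y → ¬ F Y → PackedOutside F m Y
    complemented-nonempty {Y} (y , y∈Y) Y∉F with proj₂ sat Y Y∉F
    ... | A , A∈ , dis with any? (λ i → ¬? (F? (A i)))
    ...   | no all∈ = contradiction
      (A , (λ i → decidable-stable (F? (A i)) (λ ∉F → all∈ (i , ∉F))) , dis) (proj₁ sat)
    ...   | yes (i , Ai∉F) = X , (X∈F , X-disjoint) , λ j x∈X x∈Y → avoid j x∈X x∈Y
      where
      X = A ∘ punchIn i
      Y≡Ai : Y ≡ A i
      Y≡Ai with A∈ i
      ... | inj₁ ∈F  = contradiction ∈F Ai∉F
      ... | inj₂ eq = eq
      avoid : ∀ j {x} → x ∈ X j → x ∉ Y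
      avoid j x∈X x∈Y = ∉⊥ (subst (_ ∈_) (dis (punchIn i j) i (Fin.punchInᵢ≢i i j))
        (x∈p∩q⁺ (x∈X , subst (_ ∈_) Y≡Ai x∈Y)))
      X∈F : ∀ j → F (X j)
      X∈F j with A∈ (punchIn i j)
      ... | inj₁ ∈F = ∈F
      ... | inj₂ eq = contradiction y∈Y (avoid j (subst (y ∈_) eq y∈Y))
      X-disjoint : ∀ {j l x} → x ∈ X j → x ∈ X l → j ≡ l
      X-disjoint {j} {l} x∈Xj x∈Xl = decidable-stable (j Fin.≟ l) λ j≢l →
        ∉⊥ (subst (_ ∈_) (dis _ _ (j≢l ∘ Fin.punchIn-injective i j l)) (x∈p∩q⁺ (x∈Xj , x∈Xl)))

    -- Every set misses the empty set, so for empty `Y` any packing of size m will do: one obtained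
    -- from a nonempty nonmember or, if there is none, m distinct singletons, available since m ≤ n.
    saturated⇒complemented : m ℕ.≤ n → Complemented F m
    saturated⇒complemented m≤n Y Y∉F with nonempty? Y
    ... | yes Y≢∅ = complemented-nonempty Y≢∅ Y∉F
    ... | no  Y≡∅ with anySubset? (λ Y′ → nonempty? Y′ ×-dec ¬? (F? Y′))
    ...   | yes (Y′ , Y′≢∅ , Y′∉F) =
      let X , X-packing , _ = complemented-nonempty Y′≢∅ Y′∉F
      in X , X-packing , λ _ _ x∈Y → Y≡∅ (_ , x∈Y)
    ...   | no nonempty∈F = singleton , (singleton∈F , singleton-disjoint) , λ _ _ x∈Y → Y≡∅ (_ , x∈Y)
      where
      singleton : Fin m → Subset n
      singleton j = ⁅ Fin.inject≤ j m≤n ⁆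
      singleton∈F : ∀ j → F (singleton j)
      singleton∈F j = decidable-stable (F? (singleton j)) λ ∉F →
        nonempty∈F (singleton j , (_ , x∈⁅x⁆ _) , ∉F)
      singleton-disjoint : ∀ {i j x} → x ∈ singleton i → x ∈ singleton j → i ≡ j
      singleton-disjoint {i} {j} x∈i x∈j =
        Fin.inject≤-injective m≤n m≤n i j (trans (sym (x∈⁅y⁆⇒x≡y _ x∈i)) (x∈⁅y⁆⇒x≡y _ x∈j))

    -- This is s |D| + (2^m - s) 2^t ≤ 2^n without subtraction. The exponent is lowered from |T| to
    -- `t` while the coefficient is still the natural number `c` of non-initial sets.
    card-∁-∣T∣ : m ℕ.≤ n → ∀ {T} → ¬ F T → ∀ {t} → t ℕ.≤ ∣ T ∣ →
      suc m ℕ.* card (¬? ∘ F?) ℕ.+ 2 ^ m ℕ.* 2 ^ t ℕ.≤ 2 ^ n ℕ.+ suc m ℕ.* 2 ^ t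
    card-∁-∣T∣ m≤n {T} T∉F {t} t≤ = begin
      suc m ℕ.* M ℕ.+ 2 ^ m ℕ.* 2 ^ t
        ≡⟨ cong (λ c → suc m ℕ.* M ℕ.+ c ℕ.* 2 ^ t) (card-∁ (initial? {m})) ⟨
      suc m ℕ.* M ℕ.+ (card (initial? {m}) ℕ.+ c) ℕ.* 2 ^ t
        ≡⟨ regroup (suc m) M (card (initial? {m})) c (2 ^ t) ⟩
      (suc m ℕ.* M ℕ.+ c ℕ.* 2 ^ t) ℕ.+ card (initial? {m}) ℕ.* 2 ^ t
        ≤⟨ ℕ.+-mono-≤
             (ℕ.≤-trans (ℕ.+-monoʳ-≤ (suc m ℕ.* M) (ℕ.*-monoʳ-≤ c (ℕ.^-monoʳ-≤ 2 t≤)))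
               (card-∁-bound F F? (λ B → proj₁ sat ∘ packing⇒matching) (saturated⇒complemented m≤n) T∉F))
             (ℕ.*-monoˡ-≤ (2 ^ t) (card-Initial m)) ⟩
      2 ^ n ℕ.+ suc m ℕ.* 2 ^ t ∎
      where
      open ℕ.≤-Reasoning
      M = card (¬? ∘ F?)
      c = card (¬? ∘ initial? {m})
      regroup : ∀ s M a c x → s ℕ.* M ℕ.+ (a ℕ.+ c) ℕ.* x ≡ (s ℕ.* M ℕ.+ c ℕ.* x) ℕ.+ a ℕ.* x
      regroup = ℕ-Solver.solve-∀

-- From naturals to rationals

toℚᵘ-/ : ∀ i d .{{_ : NonZero d}} → ℚ.toℚᵘ (i / d) ℚᵘ.≃ i ℚᵘ./ d
toℚᵘ-/ i (suc d) = ℚ.toℚᵘ-fromℚᵘ (ℚᵘ.mkℚᵘ i d)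

/-*-fromℕ : ∀ a d .{{_ : NonZero d}} → + a / d * fromℕ d ≡ fromℕ a
/-*-fromℕ a d@(suc _) = ℚ.toℚᵘ-injective (begin-equality
  ℚ.toℚᵘ (+ a / d * fromℕ d)              ≃⟨ ℚ.toℚᵘ-homo-* (+ a / d) (fromℕ d) ⟩
  ℚ.toℚᵘ (+ a / d) ℚᵘ.* ℚ.toℚᵘ (fromℕ d)  ≃⟨ ℚᵘ.*-cong (toℚᵘ-/ (+ a) d) (toℚᵘ-/ (+ d) 1) ⟩
  (+ a ℚᵘ./ d) ℚᵘ.* (+ d ℚᵘ./ 1)          ≃⟨ ℚᵘ.*≡* (ℤ-lemma (+ a) (+ d)) ⟩
  + a ℚᵘ./ 1                              ≃⟨ toℚᵘ-/ (+ a) 1 ⟨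
  ℚ.toℚᵘ (fromℕ a)                        ∎)
  where
  open ℚᵘ.≤-Reasoning
  ℤ-lemma : ∀ a d → (a ℤ.* d) ℤ.* + 1 ≡ a ℤ.* (d ℤ.* + 1)
  ℤ-lemma = ℤ-Solver.solve-∀

fromℕ-+ : ∀ a b → fromℕ (a ℕ.+ b) ≡ fromℕ a + fromℕ b
fromℕ-+ a b = ℚ.toℚᵘ-injective (begin-equality
  ℚ.toℚᵘ (fromℕ (a ℕ.+ b))             ≃⟨ toℚᵘ-/ (+ (a ℕ.+ b)) 1 ⟩
  + (a ℕ.+ b) ℚᵘ./ 1                   ≃⟨ ℚᵘ.*≡* (ℤ-lemma (+ a) (+ b)) ⟩
  (+ a ℚᵘ./ 1) ℚᵘ.+ (+ b ℚᵘ./ 1)       ≃⟨ ℚᵘ.+-cong (toℚᵘ-/ (+ a) 1) (toℚᵘ-/ (+ b) 1) ⟨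
  ℚ.toℚᵘ (fromℕ a) ℚᵘ.+ ℚ.toℚᵘ (fromℕ b) ≃⟨ ℚ.toℚᵘ-homo-+ (fromℕ a) (fromℕ b) ⟨
  ℚ.toℚᵘ (fromℕ a + fromℕ b)           ∎)
  where
  open ℚᵘ.≤-Reasoning
  ℤ-lemma : ∀ a b → (a ℤ.+ b) ℤ.* + 1 ≡ (a ℤ.* + 1 ℤ.+ b ℤ.* + 1) ℤ.* + 1
  ℤ-lemma = ℤ-Solver.solve-∀

fromℕ-* : ∀ a b → fromℕ (a ℕ.* b) ≡ fromℕ a * fromℕ b
fromℕ-* a b = ℚ.toℚᵘ-injective (begin-equality
  ℚ.toℚᵘ (fromℕ (a ℕ.* b))             ≃⟨ toℚᵘ-/ (+ (a ℕ.* b)) 1 ⟩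
  + (a ℕ.* b) ℚᵘ./ 1                   ≃⟨ ℚᵘ.*≡* (cong (ℤ._* + 1) (ℤ.pos-* a b)) ⟩
  (+ a ℚᵘ./ 1) ℚᵘ.* (+ b ℚᵘ./ 1)       ≃⟨ ℚᵘ.*-cong (toℚᵘ-/ (+ a) 1) (toℚᵘ-/ (+ b) 1) ⟨
  ℚ.toℚᵘ (fromℕ a) ℚᵘ.* ℚ.toℚᵘ (fromℕ b) ≃⟨ ℚ.toℚᵘ-homo-* (fromℕ a) (fromℕ b) ⟨
  ℚ.toℚᵘ (fromℕ a * fromℕ b)           ∎)
  where open ℚᵘ.≤-Reasoning

fromℕ-mono-≤ : ∀ {a b} → a ℕ.≤ b → fromℕ a ℚ.≤ fromℕ b
fromℕ-mono-≤ {a} {b} a≤b = ℚ.toℚᵘ-cancel-≤ (begin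
  ℚ.toℚᵘ (fromℕ a) ≃⟨ toℚᵘ-/ (+ a) 1 ⟩
  + a ℚᵘ./ 1       ≤⟨ ℚᵘ.*≤* (ℤ.*-monoʳ-≤-nonNeg (+ 1) (ℤ.+≤+ a≤b)) ⟩
  + b ℚᵘ./ 1       ≃⟨ toℚᵘ-/ (+ b) 1 ⟨
  ℚ.toℚᵘ (fromℕ b) ∎)
  where open ℚᵘ.≤-Reasoning

-- The denominator is cleared to reach the form of `card-∁-∣T∣`, with the binomial sum in place of
-- the number of nonmembers.
admissible⇒≤ : ∀ n s .{{_ : NonZero s}} t → Admissible n s t →
  s ℕ.* sum (map (n C_) (upTo (suc t))) ℕ.+ 2 ^ (s ∸ 1) ℕ.* 2 ^ t ℕ.≤ 2 ^ n ℕ.+ s ℕ.* 2 ^ t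
admissible⇒≤ n s@(suc _) t adm = ℤ.drop‿+≤+ (begin
  + (s ℕ.* b ℕ.+ P ℕ.* G)
    ≡⟨ cong₂ ℤ._+_ (ℤ.pos-* s b) (ℤ.pos-* P G) ⟩
  + s ℤ.* + b ℤ.+ + P ℤ.* + G
    ≡⟨ cong (ℤ._+ + P ℤ.* + G) (ℤ.*-comm (+ s) (+ b)) ⟩
  + b ℤ.* + s ℤ.+ + P ℤ.* + G
    ≤⟨ ℤ.+-monoˡ-≤ (+ P ℤ.* + G) (ℚᵘ.drop-*≤* (ℚᵘ.≤-respˡ-≃ (toℚᵘ-/ (+ b) 1)
         (ℚᵘ.≤-respʳ-≃ (toℚᵘ-/ z s) (ℚ.toℚᵘ-mono-≤ adm)))) ⟩
  z ℤ.* + 1 ℤ.+ + P ℤ.* + G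
    ≡⟨ ℤ-lemma (+ (2 ^ n)) (+ P) (+ s) (+ G) ⟩
  + (2 ^ n) ℤ.+ + s ℤ.* + G
    ≡⟨ cong (λ w → + (2 ^ n) ℤ.+ w) (ℤ.pos-* s G) ⟨
  + (2 ^ n ℕ.+ s ℕ.* G) ∎)
  where
  open ℤ.≤-Reasoning
  b = sum (map (n C_) (upTo (suc t)))
  P = 2 ^ (s ∸ 1)
  G = 2 ^ t
  z = + (2 ^ n) ℤ.- (+ P ℤ.- + s) ℤ.* + G
  ℤ-lemma : ∀ N P s G → (N ℤ.- (P ℤ.- s) ℤ.* G) ℤ.* + 1 ℤ.+ P ℤ.* G ≡ N ℤ.+ s ℤ.* G
  ℤ-lemma = ℤ-Solver.solve-∀

-- Large and small nonmembers, and the final bound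

card-∁-admissible : ∀ {m} t → m ℕ.≤ n → {F : Family n} (F? : Decidable F) → Saturated (suc m) F →
  Admissible n (suc m) t →
  suc m ℕ.* card (¬? ∘ F?) ℕ.+ 2 ^ m ℕ.* 2 ^ t ℕ.≤ 2 ^ n ℕ.+ suc m ℕ.* 2 ^ t
card-∁-admissible {n} {m} t m≤n {F} F? sat adm
  with anySubset? (λ T → ¬? (F? T) ×-dec t ℕ.≤? ∣ T ∣)
... | yes (T , T∉F , t≤) = card-∁-∣T∣ F? sat m≤n T∉F t≤
... | no  small = ℕ.≤-trans
  (ℕ.+-monoˡ-≤ _ (ℕ.*-monoʳ-≤ (suc m) (ℕ.≤-trans
    (card-mono (¬? ∘ F?) (λ Z → ∣ Z ∣ ℕ.<? suc t)
      -- Nonmembers have size below `t` here; this is weakened to size at most `t` to match the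
      -- range of the sum in `Admissible`.
      (λ Z Z∉F → ℕ.m<n⇒m<1+n (ℕ.≰⇒> (λ t≤ → small (Z , Z∉F , t≤)))))
    (card-∣∣<k n (suc t)))))
  (admissible⇒≤ n (suc m) t adm)

-- Here `a` and `b` are the numbers of members and nonmembers of `F`. Multiplying the claim by s
-- turns it into `boundℕ`.
card-bound⇒ℚ : ∀ s .{{_ : NonZero s}} {a b N} P G → a ℕ.+ b ≡ N →
  s ℕ.* b ℕ.+ P ℕ.* G ℕ.≤ N ℕ.+ s ℕ.* G →
  fromℕ a ≥ (1ℚ - + 1 / s) * fromℕ N + (+ P / s - 1ℚ) * fromℕ G
card-bound⇒ℚ s@(suc _) {a} {b} {N} P G a+b≡N bound =
  ℚ.*-cancelʳ-≤-pos (fromℕ s) {{ℚ.normalize-pos s 1}} (begin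
    ((1ℚ - q) * N′ + (p - 1ℚ) * G′) * S
      ≡⟨ expand q p N′ G′ S ⟩
    (S * N′ + (p * S) * G′) + (ℚ.- ((q * S) * N′ + S * G′))
      ≡⟨ cong₂ (λ u v → (S * N′ + u * G′) + (ℚ.- (v * N′ + S * G′))) (/-*-fromℕ P s) (/-*-fromℕ 1 s) ⟩
    (S * N′ + fromℕ P * G′) + (ℚ.- (1ℚ * N′ + S * G′))
      ≤⟨ ℚ.+-monoˡ-≤ (ℚ.- (1ℚ * N′ + S * G′)) bound′ ⟩
    (S * fromℕ a + (N′ + S * G′)) + (ℚ.- (1ℚ * N′ + S * G′))
      ≡⟨ collapse S (fromℕ a) N′ G′ ⟩
    fromℕ a * S ∎)
  where
  open ℚ.≤-Reasoning
  open ℚ.+-*-Solver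
  q = + 1 / s
  p = + P / s
  N′ = fromℕ N
  G′ = fromℕ G
  S = fromℕ s
  expand : ∀ q p N G S → ((1ℚ - q) * N + (p - 1ℚ) * G) * S ≡
                         (S * N + (p * S) * G) + (ℚ.- ((q * S) * N + S * G))
  expand = solve 5 (λ q p N G S →
    ((con 1ℚ :- q) :* N :+ (p :- con 1ℚ) :* G) :* S :=
    (S :* N :+ (p :* S) :* G) :+ (:- ((q :* S) :* N :+ S :* G))) refl
  collapse : ∀ S a N G → (S * a + (N + S * G)) + (ℚ.- (1ℚ * N + S * G)) ≡ a * S
  collapse = solve 4 (λ S a N G →
    (S :* a :+ (N :+ S :* G)) :+ (:- (con 1ℚ :* N :+ S :* G)) := a :* S) refl
  -- Adding s a to both sides of `bound` turns s b into s N.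
  boundℕ : s ℕ.* N ℕ.+ P ℕ.* G ℕ.≤ s ℕ.* a ℕ.+ (N ℕ.+ s ℕ.* G)
  boundℕ = ℕ.≤-trans
    (ℕ.≤-reflexive (trans (cong (λ w → s ℕ.* w ℕ.+ P ℕ.* G) (sym a+b≡N)) (regroup s a b (P ℕ.* G))))
    (ℕ.+-monoʳ-≤ (s ℕ.* a) bound)
    where
    regroup : ∀ s a b c → s ℕ.* (a ℕ.+ b) ℕ.+ c ≡ s ℕ.* a ℕ.+ (s ℕ.* b ℕ.+ c)
    regroup = ℕ-Solver.solve-∀
  hom : ∀ a b c d → fromℕ (a ℕ.* b ℕ.+ c ℕ.* d) ≡ fromℕ a * fromℕ b + fromℕ c * fromℕ d
  hom a b c d = trans (fromℕ-+ (a ℕ.* b) (c ℕ.* d)) (cong₂ _+_ (fromℕ-* a b) (fromℕ-* c d))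
  bound′ : S * N′ + fromℕ P * G′ ℚ.≤ S * fromℕ a + (N′ + S * G′)
  bound′ = subst₂ ℚ._≤_ (hom s N P G)
    (trans (fromℕ-+ (s ℕ.* a) _) (cong₂ _+_ (fromℕ-* s a)
      (trans (fromℕ-+ N _) (cong (_+_ N′) (fromℕ-* s G)))))
    (fromℕ-mono-≤ boundℕ)

theorem1p3 : ∀ (n s : ℕ) .{{_ : NonZero s}} → 1 ℕ.≤ n → 2 ℕ.≤ s → s ℕ.≤ suc n →
    (F : Family n) (F? : Decidable F) → Saturated s F →
    fromℕ (card F?) ≥
    (1ℚ - + 1 / s) * fromℕ (2 ^ n) + (+ (2 ^ (s ∸ 1)) / s - 1ℚ) * fromℕ (2 ^ g n s)
theorem1p3 n s@(suc m) _ _ s≤1+n@(s≤s m≤n) F F? sat =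
  card-bound⇒ℚ s (2 ^ m) (2 ^ g n s) (card-∁ F?)
    (card-∁-admissible (g n s) m≤n F? sat (proj₂ (proj₁ (g-max n s s≤1+n))))
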